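{- Let $r\geq 2$ and $s$ be fixed positive integers, and write $s=dr+p$ with $d,p$ non-negative integers and $0\leq p<r$. Then there exists $n_0(r,s)$ such that if $n>n_0(r,s)$ and $A\subset\mathbb{N}^n$ is $r$-wise $s$-union, then \[ |A|\leq \left|\mathcal{D}(\mathcal{U}(\tilde{\mathbf e}_p,d))\right|. \] Moreover, if equality holds, then $A$ is isomorphic to $\mathcal{D}(\mathcal{U}(\tilde{\mathbf e}_p,d))$.
   Context: $\mathbb{N}=\{0,1,2,\ldots\}$. For $\mathbf a\in\mathbb{N}^n$ the weight is $|\mathbf a|=\sum_{i=1}^n a_i$. The join of $\mathbf a_1,\ldots,\mathbf a_r\in\mathbb{N}^n$ is the vector whose $i$-th component is $\max\{(\mathbf a_1)_i,\ldots,(\mathbf a_r)_i\}$. A family $A\subset\mathbb{N}^n$ is $r$-wise $s$-union if the join of any $r$ vectors $\mathbf a_1,\ldots,\mathbf a_r\in A$ (not necessarily distinct) has weight at most $s$. For $\mathbf a,\mathbf b\in\mathbb{R}^n$ write $\mathbf a\prec\mathbf b$ if $a_i\leq b_i$ for all $i$. For $\mathbf a\in\mathbb{N}^n$, $\mathcal{D}(\mathbf a)=\{\mathbf c\in\mathbb{N}^n:\mathbf c\prec\mathbf a\}$, and for $B\subset\mathbb{N}^n$, $\mathcal{D}(B)=\bigcup_{\mathbf a\in B}\mathcal{D}(\mathbf a)$. For $\mathbf a\in\mathbb{N}^n$ and $d\in\mathbb{N}$, $\mathcal{U}(\mathbf a,d)=\{\mathbf a+\boldsymbol\epsilon:\boldsymbol\epsilon\in\mathbb{N}^n,\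 |\boldsymbol\epsilon|=d\}$. Let $\mathbf e_i$ be the $i$-th standard basis vector of $\mathbb{R}^n$, $\tilde{\mathbf e}_0=\mathbf 0$ and $\tilde{\mathbf e}_i=\sum_{j=1}^i\mathbf e_j$ for $1\leq i\leq n$. Two families in $\mathbb{N}^n$ are isomorphic if one is obtained from the other by a permutation of the coordinates. -}

module Defs where

open import Data.Nat using (ℕ; zero; suc; _+_; _≤_; _<_; _⊔_)
open import Data.Nat.Properties using (_<?_)
open import Data.Fin using (Fin; toℕ)
open import Data.Vec using (Vec; sum; zipWith; replicate; tabulate; lookup)
open import Data.Vec.Relation.Binary.Pointwise.Inductive using (Pointwise)
open import Data.List using (List)
open import Data.List.Membership.Propositional using (_∈_)
open import Data.List.Relation.Unary.Unique.Propositional using (Unique)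
open import Data.Product using (Σ; _×_)
open import Data.Fin.Permutation using (Permutation′; _⟨$⟩ʳ_)
open import Function.Bundles using (_⇔_)
open import Relation.Nullary.Decidable using (does)
open import Data.Bool using (if_then_else_)
open import Relation.Binary.PropositionalEquality using (_≡_)

weight : ∀ {n} → Vec ℕ n → ℕ
weight = sum

join : ∀ {n r} → (Fin r → Vec ℕ n) → Vec ℕ n
join {n} {zero}  f = replicate n 0
join {n} {suc r} f = zipWith _⊔_ (f Fin.zero) (join (λ i → f (Fin.suc i)))

UnionFamily : ∀ {n} → ℕ → ℕ → List (Vec ℕ n) → Set
UnionFamily {n} r s A =
  (f : Fin r → Vec ℕ n) → (∀ i → f i ∈ A) → weight (join f) ≤ s

_≺_ : ∀ {n} → Vec ℕ n → Vec ℕ n → Set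
a ≺ b = Pointwise _≤_ a b

Down : ∀ {n} → (Vec ℕ n → Set) → Vec ℕ n → Set
Down {n} B c = Σ (Vec ℕ n) λ a → B a × (c ≺ a)

Up : ∀ {n} → Vec ℕ n → ℕ → Vec ℕ n → Set
Up {n} a d x = Σ (Vec ℕ n) λ ε → (weight ε ≡ d) × (x ≡ zipWith _+_ a ε)

etilde : ∀ {n} → ℕ → Vec ℕ n
etilde i = tabulate λ j → if does (toℕ j <? i) then 1 else 0

Enumerates : ∀ {n} → List (Vec ℕ n) → (Vec ℕ n → Set) → Set
Enumerates {n} L P = Unique L × ((x : Vec ℕ n) → (x ∈ L) ⇔ P x)

permute : ∀ {n} → Permutation′ n → Vec ℕ n → Vec ℕ n
permute σ a = tabulate λ i → lookup a (σ ⟨$⟩ʳ i)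

IsomorphicTo : ∀ {n} → List (Vec ℕ n) → (Vec ℕ n → Set) → Set
IsomorphicTo {n} A P =
  Σ (Permutation′ n) λ σ → (a : Vec ℕ n) → (a ∈ A) ⇔ P (permute σ a)

{-# OPTIONS --safe #-}

-- Let k = n − p, so that the number of vectors in ℕᵏ of weight < e has order k^(e−1).
-- Only O(k^(d−1)) vectors have weight < d off a given bounded set of coordinates. For
-- each i let Mᵢ be the largest v such that more than C = O(k^(d−1)) members of A have
-- i-th entry ≥ v. Given a bounded set of coordinates, some a ∈ A with aᵢ ≥ Mᵢ then has
-- weight ≥ d off that set, so joins of members can be built that dominate chosen
-- entries of M and gain weight d with each member. Joining r members in this way gives
-- |M| ≤ p, and joining r − 1 of them with any a ∈ A gives |a ∨ M| ≤ d + p.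
-- If M is a 0/1 vector of weight p, the second bound says A ⊂ D(U(M, d)), which is
-- isomorphic to the extremal family. Otherwise choose greedily a bounded support S, of
-- size at least p, off which every member of A has weight ≤ d. All but O(k^(d−1))
-- members lie below M on S, and ∏(Mᵢ + 1) < 2^p, so |A| falls short of
-- 2^p · #{x ∈ ℕᵏ : |x| ≤ d}, which is a lower bound for the extremal family.
module Submission where

open import Defs
import Algebra.Properties.CommutativeMonoid.Sum as CommutativeMonoidSum
open import Data.Bool using (if_then_else_)
open import Data.Fin as Fin using (Fin; toℕ; fromℕ; punchIn; punchOut)
open import Data.Fin.Permutation using (Permutation′; _⟨$⟩ʳ_; _⟨$⟩ˡ_; inverseʳ; lift₀; insert; id)
import Data.Fin.Properties as Fin
open import Data.List as List using (List; []; _∷_; _++_; length; filter; concatMap)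
open import Data.List.Membership.Propositional using (_∈_; find; lose)
open import Data.List.Membership.Propositional.Properties
open import Data.List.Properties using (length-++; length-map; length-replicate; filter-all; filter-none)
open import Data.List.Relation.Binary.Subset.Propositional using (_⊆_)
open import Data.List.Relation.Unary.All as All using ([]; _∷_)
open import Data.List.Relation.Unary.AllPairs using ([]; _∷_)
open import Data.List.Relation.Unary.Any using (here; there; any?)
open import Data.List.Relation.Unary.Unique.Propositional using (Unique)
import Data.List.Relation.Unary.Unique.Propositional.Properties as Unique
open import Data.Nat using (ℕ; zero; suc; _+_; _*_; _∸_; _^_; _≤_; _<_; _⊔_; _⊓_; z≤n; s≤s; _≤?_; _<?_; >-nonZero)
open import Data.Nat.Properties hiding (_≤?_; _<?_)
open import Data.Nat.Solver using (module +-*-Solver)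
open import Data.Product using (Σ; ∃; _×_; _,_; proj₁; proj₂)
open import Data.Sum using (_⊎_; inj₁; inj₂)
open import Data.Unit using (⊤; tt)
open import Data.Vec as Vec using (Vec; []; _∷_; lookup; zipWith; replicate; tabulate)
import Data.Vec.Properties as Vec
open import Data.Vec.Relation.Binary.Pointwise.Inductive as Pointwise using ([]; _∷_)
open import Function using (_∘_; mk⇔; Equivalence)
open import Relation.Binary using (DecidableEquality)
open import Relation.Binary.PropositionalEquality
open import Relation.Nullary using (¬_; yes; no; contradiction; does)
open import Relation.Nullary.Decidable using (dec-false)
open import Relation.Unary using (Decidable)

-- Joins, weights and supports of vectors.

infixr 6 _∨_

_∨_ : ∀ {n} → Vec ℕ n → Vec ℕ n → Vec ℕ n
_∨_ = zipWith _⊔_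

≺-refl : ∀ {n} {x : Vec ℕ n} → x ≺ x
≺-refl = Pointwise.refl ≤-refl

≺-trans : ∀ {n} {x y z : Vec ℕ n} → x ≺ y → y ≺ z → x ≺ z
≺-trans = Pointwise.trans ≤-trans

x≺x∨y : ∀ {n} (x y : Vec ℕ n) → x ≺ (x ∨ y)
x≺x∨y [] [] = []
x≺x∨y (a ∷ x) (b ∷ y) = m≤m⊔n a b ∷ x≺x∨y x y

y≺x∨y : ∀ {n} (x y : Vec ℕ n) → y ≺ (x ∨ y)
y≺x∨y [] [] = []
y≺x∨y (a ∷ x) (b ∷ y) = m≤n⊔m a b ∷ y≺x∨y x y

∨-lub : ∀ {n} {x y z : Vec ℕ n} → x ≺ z → y ≺ z → (x ∨ y) ≺ z
∨-lub [] [] = []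
∨-lub (p ∷ ps) (q ∷ qs) = ⊔-lub p q ∷ ∨-lub ps qs

lookup⁻ : ∀ {n} {x y : Vec ℕ n} → (∀ i → lookup x i ≤ lookup y i) → x ≺ y
lookup⁻ {x = []}    {[]}    h = []
lookup⁻ {x = _ ∷ _} {_ ∷ _} h = h Fin.zero ∷ lookup⁻ (h ∘ Fin.suc)

weight-mono : ∀ {n} {x y : Vec ℕ n} → x ≺ y → weight x ≤ weight y
weight-mono [] = z≤n
weight-mono (p ∷ ps) = +-mono-≤ p (weight-mono ps)

lookup≤weight : ∀ {n} (x : Vec ℕ n) i → lookup x i ≤ weight x
lookup≤weight (a ∷ x) Fin.zero    = m≤m+n a _
lookup≤weight (a ∷ x) (Fin.suc i) = ≤-trans (lookup≤weight x i) (m≤n+m _ a)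

weight-∨-≤ : ∀ {n} (x y : Vec ℕ n) → weight (x ∨ y) ≤ weight x + weight y
weight-∨-≤ [] [] = z≤n
weight-∨-≤ (a ∷ x) (b ∷ y) = begin
  a ⊔ b + weight (x ∨ y)              ≤⟨ +-mono-≤ (m⊔n≤m+n a b) (weight-∨-≤ x y) ⟩
  (a + b) + (weight x + weight y)     ≡⟨ solve 4 (λ a b x y → (a :+ b) :+ (x :+ y) := (a :+ x) :+ (b :+ y)) refl a b (weight x) (weight y) ⟩
  (a + weight x) + (b + weight y)     ∎
  where open ≤-Reasoning; open +-*-Solver

-- The first argument stands for its support, the set of coordinates where it is nonzero.
weightOff : ∀ {n} → Vec ℕ n → Vec ℕ n → ℕ
weightOff []          []      = 0
weightOff (zero  ∷ b) (a ∷ x) = a + weightOff b x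
weightOff (suc _ ∷ b) (_ ∷ x) = weightOff b x

-- On the support of `b` the join is at least `b`, and off it the join equals `x`. So a member of
-- weight at least `d` off the support of `b` raises the weight of the join by `d`.
weight-∨-≥ : ∀ {n} (b x : Vec ℕ n) → weight b + weightOff b x ≤ weight (b ∨ x)
weight-∨-≥ [] [] = z≤n
weight-∨-≥ (zero ∷ b) (a ∷ x) = begin
  weight b + (a + weightOff b x)  ≡⟨ solve 3 (λ w a o → w :+ (a :+ o) := a :+ (w :+ o)) refl (weight b) a _ ⟩
  a + (weight b + weightOff b x)  ≤⟨ +-monoʳ-≤ a (weight-∨-≥ b x) ⟩
  a + weight (b ∨ x)              ∎
  where open ≤-Reasoning; open +-*-Solver
weight-∨-≥ (suc k ∷ b) (a ∷ x) = begin
  suc k + weight b + weightOff b x    ≡⟨ +-assoc (suc k) _ _ ⟩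
  suc k + (weight b + weightOff b x)  ≤⟨ +-mono-≤ (m≤m⊔n (suc k) a) (weight-∨-≥ b x) ⟩
  suc k ⊔ a + weight (b ∨ x)          ∎
  where open ≤-Reasoning

weightOff-antitone : ∀ {n} {b c : Vec ℕ n} → b ≺ c → ∀ x → weightOff c x ≤ weightOff b x
weightOff-antitone [] [] = z≤n
weightOff-antitone {b = zero ∷ _}  {zero ∷ _}  (_ ∷ p) (a ∷ x) = +-monoʳ-≤ a (weightOff-antitone p x)
weightOff-antitone {b = zero ∷ _}  {suc _ ∷ _} (_ ∷ p) (a ∷ x) = ≤-trans (weightOff-antitone p x) (m≤n+m _ a)
weightOff-antitone {b = suc _ ∷ _} {suc _ ∷ _} (_ ∷ p) (a ∷ x) = weightOff-antitone p x

zeros : ∀ {n} → Vec ℕ n → ℕ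
zeros []          = 0
zeros (zero  ∷ b) = suc (zeros b)
zeros (suc _ ∷ b) = zeros b

zeros-antitone : ∀ {n} {b c : Vec ℕ n} → b ≺ c → zeros c ≤ zeros b
zeros-antitone [] = z≤n
zeros-antitone {b = zero ∷ _}  {zero ∷ _}  (_ ∷ p) = s≤s (zeros-antitone p)
zeros-antitone {b = zero ∷ _}  {suc _ ∷ _} (_ ∷ p) = m≤n⇒m≤1+n (zeros-antitone p)
zeros-antitone {b = suc _ ∷ _} {suc _ ∷ _} (_ ∷ p) = zeros-antitone p

-- The list repeats each i with multiplicity xᵢ, so that its length is the weight of x.
support : ∀ {n} → Vec ℕ n → List (Fin n)
support []      = []
support (a ∷ x) = List.replicate a Fin.zero ++ List.map Fin.suc (support x)

length-support : ∀ {n} (x : Vec ℕ n) → length (support x) ≡ weight x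
length-support [] = refl
length-support (a ∷ x) = begin
  length (List.replicate a Fin.zero ++ List.map Fin.suc (support x))  ≡⟨ length-++ (List.replicate a Fin.zero) ⟩
  length (List.replicate a (Fin.zero {_})) + length (List.map Fin.suc (support x))  ≡⟨ cong₂ _+_ (length-replicate a) (trans (length-map Fin.suc (support x)) (length-support x)) ⟩
  a + weight x ∎
  where open ≡-Reasoning

∈-support : ∀ {n} (x : Vec ℕ n) i → 0 < lookup x i → i ∈ support x
∈-support (suc a ∷ x) Fin.zero    _ = here refl
∈-support (a ∷ x)     (Fin.suc i) h = ∈-++⁺ʳ (List.replicate a Fin.zero) (∈-map⁺ Fin.suc (∈-support x i h))

-- Listing and counting the vectors in a region.

addHead : ∀ {n} → Vec ℕ (suc n) → Vec ℕ (suc n)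
addHead (a ∷ x) = suc a ∷ x

box : ∀ {n} → ℕ → List (Vec ℕ n) → List (Vec ℕ (suc n))
box zero    xs = List.map (0 ∷_) xs
box (suc m) xs = List.map (0 ∷_) xs ++ List.map addHead (box m xs)

-- The vectors that are at most `M` on the support of `b` and have weight less than `e` off it,
-- where `M` is ignored. A free entry is either 0 or obtained by raising a smaller one at the cost
-- of one unit of `e`, which is Pascal's rule for `simplex`.
region : ∀ {n} → Vec ℕ n → Vec ℕ n → ℕ → List (Vec ℕ n)
region []          []      zero    = []
region []          []      (suc e) = [] ∷ []
region (zero ∷ b)  (m ∷ M) zero    = []
region (zero ∷ b)  (m ∷ M) (suc e) =
  List.map (0 ∷_) (region b M (suc e)) ++ List.map addHead (region (zero ∷ b) (m ∷ M) e)
region (suc _ ∷ b) (m ∷ M) e       = box m (region b M e)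

-- simplex k e = C(k + e − 1, k) is the number of vectors in ℕᵏ of weight less than e.
simplex : ℕ → ℕ → ℕ
simplex k       zero    = 0
simplex zero    (suc e) = 1
simplex (suc k) (suc e) = simplex k (suc e) + simplex (suc k) e

-- The product of Mᵢ + 1 over the support of `b`: the number of choices that `region` leaves there.
boxes : ∀ {n} → Vec ℕ n → Vec ℕ n → ℕ
boxes []          []      = 1
boxes (zero  ∷ b) (_ ∷ M) = boxes b M
boxes (suc _ ∷ b) (m ∷ M) = suc m * boxes b M

length-box : ∀ {n} m (xs : List (Vec ℕ n)) → length (box m xs) ≡ suc m * length xs
length-box zero    xs = trans (length-map (0 ∷_) xs) (sym (+-identityʳ _))
length-box (suc m) xs = trans (length-++ (List.map (0 ∷_) xs))
  (cong₂ _+_ (length-map (0 ∷_) xs) (trans (length-map addHead (box m xs)) (length-box m xs)))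

length-region : ∀ {n} (b M : Vec ℕ n) e → length (region b M e) ≡ boxes b M * simplex (zeros b) e
length-region []          []      zero    = refl
length-region []          []      (suc e) = refl
length-region (zero ∷ b)  (m ∷ M) zero    = sym (*-zeroʳ (boxes b M))
length-region (zero ∷ b)  (m ∷ M) (suc e) = begin
  length (List.map (0 ∷_) R ++ List.map addHead R′)  ≡⟨ length-++ (List.map (0 ∷_) R) ⟩
  length (List.map (0 ∷_) R) + length (List.map addHead R′)  ≡⟨ cong₂ _+_ (length-map _ R) (length-map _ R′) ⟩
  length R + length R′  ≡⟨ cong₂ _+_ (length-region b M (suc e)) (length-region (zero ∷ b) (m ∷ M) e) ⟩
  boxes b M * simplex (zeros b) (suc e) + boxes b M * simplex (suc (zeros b)) e  ≡⟨ *-distribˡ-+ (boxes b M) _ _ ⟨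
  boxes b M * (simplex (zeros b) (suc e) + simplex (suc (zeros b)) e)  ∎
  where open ≡-Reasoning
        R  = region b M (suc e)
        R′ = region (zero ∷ b) (m ∷ M) e
length-region (suc _ ∷ b) (m ∷ M) e = begin
  length (box m (region b M e))  ≡⟨ length-box m (region b M e) ⟩
  suc m * length (region b M e)  ≡⟨ cong (suc m *_) (length-region b M e) ⟩
  suc m * (boxes b M * simplex (zeros b) e)  ≡⟨ *-assoc (suc m) (boxes b M) _ ⟨
  suc m * boxes b M * simplex (zeros b) e  ∎
  where open ≡-Reasoning

addHead-injective : ∀ {n} {x y : Vec ℕ (suc n)} → addHead x ≡ addHead y → x ≡ y
addHead-injective {x = _ ∷ _} {_ ∷ _} refl = refl

split-unique : ∀ {n} {xs : List (Vec ℕ n)} {ys : List (Vec ℕ (suc n))} → Unique xs → Unique ys →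
               Unique (List.map (0 ∷_) xs ++ List.map addHead ys)
split-unique u v = Unique.++⁺ (Unique.map⁺ Vec.∷-injectiveʳ u) (Unique.map⁺ addHead-injective v) disjoint
  where
  disjoint : ∀ {x} → ¬ (x ∈ List.map (0 ∷_) _ × x ∈ List.map addHead _)
  disjoint (p , q) with ∈-map⁻ (0 ∷_) p | ∈-map⁻ addHead q
  ... | _ , _ , refl | (_ ∷ _) , _ , ()

box-unique : ∀ {n} m {xs : List (Vec ℕ n)} → Unique xs → Unique (box m xs)
box-unique zero    u = Unique.map⁺ Vec.∷-injectiveʳ u
box-unique (suc m) u = split-unique u (box-unique m u)

region-unique : ∀ {n} (b M : Vec ℕ n) e → Unique (region b M e)
region-unique []          []      zero    = []
region-unique []          []      (suc e) = [] ∷ []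
region-unique (zero ∷ b)  (m ∷ M) zero    = []
region-unique (zero ∷ b)  (m ∷ M) (suc e) =
  split-unique (region-unique b M (suc e)) (region-unique (zero ∷ b) (m ∷ M) e)
region-unique (suc _ ∷ b) (m ∷ M) e       = box-unique m (region-unique b M e)

-- The order `x ≺ M` restricted to the support of `b`.
Under : ∀ {n} → Vec ℕ n → Vec ℕ n → Vec ℕ n → Set
Under []          []      []      = ⊤
Under (zero  ∷ b) (_ ∷ M) (_ ∷ x) = Under b M x
Under (suc _ ∷ b) (m ∷ M) (a ∷ x) = a ≤ m × Under b M x

∈-box⁺ : ∀ {n a m} {x : Vec ℕ n} {xs} → a ≤ m → x ∈ xs → (a ∷ x) ∈ box m xs
∈-box⁺ {m = zero}  z≤n h = ∈-map⁺ _ h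
∈-box⁺ {m = suc m} z≤n h = ∈-++⁺ˡ (∈-map⁺ _ h)
∈-box⁺ (s≤s p) h = ∈-++⁺ʳ (List.map (0 ∷_) _) (∈-map⁺ addHead (∈-box⁺ p h))

∈-box⁻ : ∀ {n} m {a} {x : Vec ℕ n} {xs} → (a ∷ x) ∈ box m xs → a ≤ m × x ∈ xs
∈-box⁻ zero h with ∈-map⁻ (0 ∷_) h
... | _ , q , refl = z≤n , q
∈-box⁻ (suc m) {xs = xs} h with ∈-++⁻ (List.map (0 ∷_) xs) h
... | inj₁ h′ with ∈-map⁻ (0 ∷_) h′
...   | _ , q , refl = z≤n , q
∈-box⁻ (suc m) h | inj₂ h′ with ∈-map⁻ addHead h′
...   | (_ ∷ _) , q , refl with ∈-box⁻ m q
...     | p , q′ = s≤s p , q′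

∈-region⁺ : ∀ {n} (b M : Vec ℕ n) e {x} → Under b M x → weightOff b x < e → x ∈ region b M e
∈-region⁺ [] [] (suc e) {[]} _ _ = here refl
∈-region⁺ (zero ∷ b) (m ∷ M) (suc e) {zero ∷ x} u h = ∈-++⁺ˡ (∈-map⁺ _ (∈-region⁺ b M (suc e) u h))
∈-region⁺ (zero ∷ b) (m ∷ M) (suc e) {suc a ∷ x} u (s≤s h) =
  ∈-++⁺ʳ (List.map (0 ∷_) _) (∈-map⁺ addHead (∈-region⁺ (zero ∷ b) (m ∷ M) e {a ∷ x} u h))
∈-region⁺ (suc _ ∷ b) (m ∷ M) e {a ∷ x} (p , u) h = ∈-box⁺ p (∈-region⁺ b M e u h)

∈-region⁻ : ∀ {n} (b M : Vec ℕ n) e {x} → x ∈ region b M e → Under b M x × weightOff b x < e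
∈-region⁻ [] [] (suc e) {[]} _ = tt , s≤s z≤n
∈-region⁻ (zero ∷ b) (m ∷ M) (suc e) {a ∷ x} h with ∈-++⁻ (List.map (0 ∷_) (region b M (suc e))) h
... | inj₁ h′ with ∈-map⁻ (0 ∷_) h′
...   | _ , q , refl = ∈-region⁻ b M (suc e) q
∈-region⁻ (zero ∷ b) (m ∷ M) (suc e) {a ∷ x} h | inj₂ h′ with ∈-map⁻ addHead h′
...   | (_ ∷ _) , q , refl with ∈-region⁻ (zero ∷ b) (m ∷ M) e q
...     | u , l = u , s≤s l
∈-region⁻ (suc _ ∷ b) (m ∷ M) e {a ∷ x} h with ∈-box⁻ m h
... | p , q with ∈-region⁻ b M e q
...   | u , l = (p , u) , l

-- The equality case of `weight-∨-≥`: on its support `b` absorbs `x`.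
Under-self : ∀ {n} (b x : Vec ℕ n) → Under b b x → weight (x ∨ b) ≡ weight b + weightOff b x
Under-self [] [] u = refl
Under-self (zero ∷ b) (a ∷ x) u = begin
  a ⊔ 0 + weight (x ∨ b)          ≡⟨ cong₂ _+_ (⊔-identityʳ a) (Under-self b x u) ⟩
  a + (weight b + weightOff b x)  ≡⟨ solve 3 (λ w a o → a :+ (w :+ o) := w :+ (a :+ o)) refl (weight b) a _ ⟩
  weight b + (a + weightOff b x)  ∎
  where open ≡-Reasoning; open +-*-Solver
Under-self (suc k ∷ b) (a ∷ x) (p , u) = begin
  a ⊔ suc k + weight (x ∨ b)          ≡⟨ cong₂ _+_ (m≤n⇒m⊔n≡n p) (Under-self b x u) ⟩
  suc k + (weight b + weightOff b x)  ≡⟨ +-assoc (suc k) _ _ ⟨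
  suc k + weight b + weightOff b x    ∎
  where open ≡-Reasoning

-- Growth of the simplex numbers.

-- The two absorption identities for binomial coefficients. Pascal's rule splits off a term to which
-- the other identity applies, hence the mutual induction.
simplex-suc-e : ∀ k e → e * simplex k (suc e) ≡ (k + e) * simplex k e
simplex-suc-k : ∀ k e → suc k * simplex (suc k) e ≡ (k + e) * simplex k e

simplex-suc-e zero    zero    = refl
simplex-suc-e zero    (suc e) = refl
simplex-suc-e (suc k) e = begin
  e * (simplex k (suc e) + simplex (suc k) e)         ≡⟨ *-distribˡ-+ e (simplex k (suc e)) _ ⟩
  e * simplex k (suc e) + e * simplex (suc k) e       ≡⟨ cong (_+ e * simplex (suc k) e) (trans (simplex-suc-e k e) (sym (simplex-suc-k k e))) ⟩
  suc k * simplex (suc k) e + e * simplex (suc k) e   ≡⟨ *-distribʳ-+ (simplex (suc k) e) (suc k) e ⟨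
  (suc k + e) * simplex (suc k) e                     ∎
  where open ≡-Reasoning

simplex-suc-k k zero    = trans (*-zeroʳ (suc k)) (sym (*-zeroʳ (k + 0)))
simplex-suc-k k (suc e) = begin
  suc k * (simplex k (suc e) + simplex (suc k) e)         ≡⟨ *-distribˡ-+ (suc k) (simplex k (suc e)) _ ⟩
  suc k * simplex k (suc e) + suc k * simplex (suc k) e   ≡⟨ cong (suc k * simplex k (suc e) +_) (trans (simplex-suc-k k e) (sym (simplex-suc-e k e))) ⟩
  suc k * simplex k (suc e) + e * simplex k (suc e)       ≡⟨ *-distribʳ-+ (simplex k (suc e)) (suc k) e ⟨
  (suc k + e) * simplex k (suc e)                         ≡⟨ cong (_* simplex k (suc e)) (+-suc k e) ⟨
  (k + suc e) * simplex k (suc e)                         ∎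
  where open ≡-Reasoning

simplex-pos : ∀ k e → 0 < simplex k (suc e)
simplex-pos zero    e = s≤s z≤n
simplex-pos (suc k) e = ≤-trans (simplex-pos k e) (m≤m+n _ _)

-- By `simplex-suc-e` the ratio of the two numbers is (k + e) / e, which exceeds `c` once `k` is at
-- least `c * e`. This is what makes O(k^(d-1)) errors negligible for large `k`.
simplex-growth : ∀ c k e → c * e ≤ k → c * simplex k e < simplex k (suc e)
simplex-growth c k zero    _ = subst (_< simplex k 1) (sym (*-zeroʳ c)) (simplex-pos k 0)
simplex-growth c k e@(suc e′) h = *-cancelˡ-< e _ _ (begin-strict
  e * (c * N)      ≡⟨ solve 3 (λ e c N → e :* (c :* N) := c :* e :* N) refl e c N ⟩
  c * e * N        ≤⟨ *-monoˡ-≤ N h ⟩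
  k * N            <⟨ m<m+n (k * N) (*-mono-≤ (s≤s (z≤n {e′})) (simplex-pos k e′)) ⟩
  k * N + e * N    ≡⟨ *-distribʳ-+ N k e ⟨
  (k + e) * N      ≡⟨ simplex-suc-e k e ⟨
  e * simplex k (suc e) ∎)
  where open ≤-Reasoning; open +-*-Solver; N = simplex k e

simplex-mono : ∀ {k l} e → k ≤ l → simplex k e ≤ simplex l e
simplex-mono zero    h = z≤n
simplex-mono {zero}  {l} (suc e) h = simplex-pos l e
simplex-mono {suc k} {suc l} (suc e) (s≤s h) = +-mono-≤ (simplex-mono (suc e) h) (simplex-mono e (s≤s h))

-- Pigeonhole for lists without repetition.

unique-⊆⇒length≤ : ∀ {A : Set} {xs ys : List A} → Unique xs → xs ⊆ ys → length xs ≤ length ys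
unique-⊆⇒length≤ {xs = []} [] h = z≤n
unique-⊆⇒length≤ {xs = x ∷ xs} (x∉ ∷ u) h with ∈-∃++ (h (here refl))
... | ys , zs , refl = begin
  suc (length xs)              ≤⟨ s≤s (unique-⊆⇒length≤ u xs⊆) ⟩
  suc (length (ys ++ zs))      ≡⟨ cong suc (length-++ ys) ⟩
  suc (length ys + length zs)  ≡⟨ +-suc (length ys) (length zs) ⟨
  length ys + suc (length zs)  ≡⟨ length-++ ys ⟨
  length (ys ++ x ∷ zs)        ∎
  where
  open ≤-Reasoning
  xs⊆ : xs ⊆ ys ++ zs
  xs⊆ {y} y∈ with ∈-++⁻ ys (h (there y∈))
  ... | inj₁ q         = ∈-++⁺ˡ q
  ... | inj₂ (here eq) = contradiction (sym eq) (All.lookup x∉ y∈)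
  ... | inj₂ (there q) = ∈-++⁺ʳ ys q

unique-⊆-length≥⇒⊇ : ∀ {A : Set} → DecidableEquality A → {xs ys : List A} →
                     Unique xs → xs ⊆ ys → length ys ≤ length xs → ys ⊆ xs
unique-⊆-length≥⇒⊇ _≟_ {xs} u h len {y} y∈ with any? (y ≟_) xs
... | yes y∈xs = y∈xs
... | no  y∉xs = contradiction len (<⇒≱ (unique-⊆⇒length≤ (All.tabulate (λ z∈ eq → y∉xs (lose z∈ eq)) ∷ u) y∷xs⊆))
  where
  y∷xs⊆ : y ∷ xs ⊆ _
  y∷xs⊆ (here refl) = y∈
  y∷xs⊆ (there q)   = h q

-- Bounds on the product of the Mᵢ + 1.

boxes-∷ : ∀ {n} b₀ (b : Vec ℕ n) m M → boxes (b₀ ∷ b) (m ∷ M) ≤ suc m * boxes b M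
boxes-∷ zero    b m M = m≤m+n _ _
boxes-∷ (suc _) b m M = ≤-refl

1+m≤2^m : ∀ m → suc m ≤ 2 ^ m
1+m≤2^m zero    = ≤-refl
1+m≤2^m (suc m) = begin
  suc (suc m)        ≤⟨ s≤s (1+m≤2^m m) ⟩
  1 + 2 ^ m          ≤⟨ +-mono-≤ (m^n>0 2 m) (m≤m+n (2 ^ m) 0) ⟩
  2 ^ suc m          ∎
  where open ≤-Reasoning

1+m<2^m : ∀ {m} → 1 < m → suc m < 2 ^ m
1+m<2^m {suc zero} (s≤s ())
1+m<2^m {suc (suc m)} _ = begin
  2 + suc (suc m)              ≤⟨ +-monoˡ-≤ (suc (suc m)) (*-monoʳ-≤ 2 (m^n>0 2 m)) ⟩
  2 * 2 ^ m + suc (suc m)      ≤⟨ +-monoʳ-≤ (2 * 2 ^ m) (1+m≤2^m (suc m)) ⟩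
  2 * 2 ^ m + 2 * 2 ^ m        ≡⟨ cong (2 * 2 ^ m +_) (+-identityʳ (2 * 2 ^ m)) ⟨
  2 ^ suc (suc m)              ∎
  where open ≤-Reasoning

boxes-≤ : ∀ {n} (b M : Vec ℕ n) → boxes b M ≤ 2 ^ weight M
boxes-≤ [] [] = ≤-refl
boxes-≤ (b₀ ∷ b) (m ∷ M) = begin
  boxes (b₀ ∷ b) (m ∷ M)  ≤⟨ boxes-∷ b₀ b m M ⟩
  suc m * boxes b M       ≤⟨ *-mono-≤ (1+m≤2^m m) (boxes-≤ b M) ⟩
  2 ^ m * 2 ^ weight M    ≡⟨ ^-distribˡ-+-* 2 m (weight M) ⟨
  2 ^ (m + weight M)      ∎
  where open ≤-Reasoning

Binary : ∀ {n} → Vec ℕ n → Set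
Binary M = ∀ i → lookup M i ≤ 1

binary? : ∀ {n} → Decidable (Binary {n})
binary? M = Fin.all? λ i → lookup M i ≤? 1

-- An entry m ≥ 2 has m + 1 < 2^m, and this strict loss survives multiplication by the other
-- factors.
boxes-< : ∀ {n} (b M : Vec ℕ n) → ¬ Binary M → boxes b M < 2 ^ weight M
boxes-< [] [] ¬bin = contradiction (λ ()) ¬bin
boxes-< (b₀ ∷ b) (m ∷ M) ¬bin with m ≤? 1
... | yes m≤1 = begin-strict
  boxes (b₀ ∷ b) (m ∷ M)  ≤⟨ boxes-∷ b₀ b m M ⟩
  suc m * boxes b M       <⟨ *-monoʳ-< (suc m) (boxes-< b M λ bin → ¬bin λ { Fin.zero → m≤1 ; (Fin.suc i) → bin i }) ⟩
  suc m * 2 ^ weight M    ≤⟨ *-monoˡ-≤ (2 ^ weight M) (1+m≤2^m m) ⟩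
  2 ^ m * 2 ^ weight M    ≡⟨ ^-distribˡ-+-* 2 m (weight M) ⟨
  2 ^ (m + weight M)      ∎
  where open ≤-Reasoning
... | no m≰1 = begin-strict
  boxes (b₀ ∷ b) (m ∷ M)  ≤⟨ boxes-∷ b₀ b m M ⟩
  suc m * boxes b M       ≤⟨ *-monoʳ-≤ (suc m) (boxes-≤ b M) ⟩
  suc m * 2 ^ weight M    <⟨ *-monoˡ-< (2 ^ weight M) {{>-nonZero (m^n>0 2 (weight M))}} (1+m<2^m (≰⇒> m≰1)) ⟩
  2 ^ m * 2 ^ weight M    ≡⟨ ^-distribˡ-+-* 2 m (weight M) ⟨
  2 ^ (m + weight M)      ∎
  where open ≤-Reasoning

-- The support of `b` has at most `weight b` coordinates, each contributing a factor s + 1.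
boxes-replicate : ∀ {n} (b : Vec ℕ n) s → boxes b (replicate n s) ≤ suc s ^ weight b
boxes-replicate [] s = ≤-refl
boxes-replicate (zero ∷ b) s = boxes-replicate b s
boxes-replicate (suc k ∷ b) s =
  *-monoʳ-≤ (suc s) (≤-trans (boxes-replicate b s) (^-monoʳ-≤ (suc s) (m≤n+m (weight b) k)))

Under-replicate : ∀ {n s} (b x : Vec ℕ n) → (∀ i → lookup x i ≤ s) → Under b (replicate n s) x
Under-replicate [] [] h = tt
Under-replicate (zero  ∷ b) (_ ∷ x) h = Under-replicate b x (h ∘ Fin.suc)
Under-replicate (suc _ ∷ b) (_ ∷ x) h = h Fin.zero , Under-replicate b x (h ∘ Fin.suc)

-- Separates the members counted by a region from the exceptional ones, each charged to a coordinate
-- of the support.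
Under-or-exceeds : ∀ {n} (b M x : Vec ℕ n) → Under b M x ⊎ ∃ λ i → i ∈ support b × lookup M i < lookup x i
Under-or-exceeds [] [] [] = inj₁ tt
Under-or-exceeds (b₀ ∷ b) (m ∷ M) (a ∷ x) with Under-or-exceeds b M x
... | inj₂ (i , i∈ , h) = inj₂ (Fin.suc i , ∈-++⁺ʳ (List.replicate b₀ Fin.zero) (∈-map⁺ Fin.suc i∈) , h)
Under-or-exceeds (zero ∷ b) (m ∷ M) (a ∷ x) | inj₁ u = inj₁ u
Under-or-exceeds (suc k ∷ b) (m ∷ M) (a ∷ x) | inj₁ u with a ≤? m
... | yes a≤m = inj₁ (a≤m , u)
... | no  a≰m = inj₂ (Fin.zero , here refl , ≰⇒> a≰m)

-- The vector `etilde p` and membership in the extremal family.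

weight-etilde : ∀ {n p} → p ≤ n → weight (etilde {n} p) ≡ p
weight-etilde {zero}  z≤n = refl
weight-etilde {suc n} z≤n = weight-etilde {n} z≤n
weight-etilde (s≤s h) = cong suc (weight-etilde h)

zeros-etilde : ∀ {n p} → p ≤ n → p + zeros (etilde {n} p) ≡ n
zeros-etilde {zero}  z≤n = refl
zeros-etilde {suc n} z≤n = cong suc (zeros-etilde {n} z≤n)
zeros-etilde (s≤s h) = cong suc (zeros-etilde h)

boxes-etilde : ∀ {n p} → p ≤ n → boxes (etilde {n} p) (etilde p) ≡ 2 ^ p
boxes-etilde {zero}  z≤n = refl
boxes-etilde {suc n} z≤n = boxes-etilde {n} z≤n
boxes-etilde (s≤s h) = cong (2 *_) (boxes-etilde h)

-- The truncated difference of `x` and `b` has weight `weight (x ∨ b)` minus `weight b`, at most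
-- `d`. Raising its first entry, which exists in positive dimension, brings the weight to exactly
-- `d` as `Up` demands.
Down-Up⁺ : ∀ {n} {b x : Vec ℕ (suc n)} {d} → weight (x ∨ b) ≤ d + weight b → Down (Up b d) x
Down-Up⁺ {b = b} {x} {d} h = zipWith _+_ b ε , (ε , weight-ε , refl) , ≺-trans (excess≻ x b) (+-mono-≺ b ε′≺ε)
  where
  excess : ∀ {n} → Vec ℕ n → Vec ℕ n → Vec ℕ n
  excess = zipWith _∸_

  ⊔≡∸+ : ∀ m n → m ⊔ n ≡ (m ∸ n) + n
  ⊔≡∸+ zero    n       = sym (cong (_+ n) (0∸n≡0 n))
  ⊔≡∸+ (suc m) zero    = sym (+-identityʳ (suc m))
  ⊔≡∸+ (suc m) (suc n) = trans (cong suc (⊔≡∸+ m n)) (sym (+-suc (m ∸ n) n))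

  weight-excess : ∀ {n} (x b : Vec ℕ n) → weight (excess x b) + weight b ≡ weight (x ∨ b)
  weight-excess [] [] = refl
  weight-excess (a ∷ x) (c ∷ b) = begin
    (a ∸ c) + weight (excess x b) + (c + weight b)    ≡⟨ solve 4 (λ a u c w → a :+ u :+ (c :+ w) := a :+ c :+ (u :+ w)) refl (a ∸ c) (weight (excess x b)) c (weight b) ⟩
    (a ∸ c) + c + (weight (excess x b) + weight b)    ≡⟨ cong₂ _+_ (sym (⊔≡∸+ a c)) (weight-excess x b) ⟩
    a ⊔ c + weight (x ∨ b)                            ∎
    where open ≡-Reasoning; open +-*-Solver

  excess≻ : ∀ {n} (x b : Vec ℕ n) → x ≺ zipWith _+_ b (excess x b)
  excess≻ [] [] = []
  excess≻ (a ∷ x) (c ∷ b) = m≤n+m∸n a c ∷ excess≻ x b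

  +-mono-≺ : ∀ {n} (b : Vec ℕ n) {x y} → x ≺ y → zipWith _+_ b x ≺ zipWith _+_ b y
  +-mono-≺ [] [] = []
  +-mono-≺ (c ∷ b) (p ∷ ps) = +-monoʳ-≤ c p ∷ +-mono-≺ b ps

  raise : ∀ {n} (x : Vec ℕ (suc n)) {d} → weight x ≤ d → ∃ λ y → x ≺ y × weight y ≡ d
  raise (a ∷ x) {d} h = (d ∸ weight x) ∷ x , m+n≤o⇒m≤o∸n a h ∷ ≺-refl , m∸n+n≡m (m+n≤o⇒n≤o a h)

  raised = raise (excess x b) (+-cancelʳ-≤ (weight b) (weight (excess x b)) d (subst (_≤ d + weight b) (sym (weight-excess x b)) h))
  ε = proj₁ raised
  ε′≺ε = proj₁ (proj₂ raised)
  weight-ε = proj₂ (proj₂ raised)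

truncate : ∀ {n} (x : Vec ℕ n) {w} → w ≤ weight x → ∃ λ y → y ≺ x × weight y ≡ w
truncate [] z≤n = [] , [] , refl
truncate (a ∷ x) {w} h with truncate x {w ∸ a} (m≤n+o⇒m∸n≤o w a h)
... | y , y≺x , eq = (a ⊓ w) ∷ y , m⊓n≤m a w ∷ y≺x , trans (cong (a ⊓ w +_) eq) (m⊓n+n∸m≡n a w)

-- Permutations of the coordinates.

weight-permute : ∀ {n} (σ : Permutation′ n) (x : Vec ℕ n) → weight (permute σ x) ≡ weight x
weight-permute σ x = begin
  weight (tabulate (λ i → lookup x (σ ⟨$⟩ʳ i)))  ≡⟨ weight-tabulate (λ i → lookup x (σ ⟨$⟩ʳ i)) ⟩
  Sum.sum (λ i → lookup x (σ ⟨$⟩ʳ i))            ≡⟨ Sum.sum-permute (lookup x) σ ⟨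
  Sum.sum (lookup x)                              ≡⟨ weight-tabulate (lookup x) ⟨
  weight (tabulate (lookup x))                    ≡⟨ cong weight (Vec.tabulate∘lookup x) ⟩
  weight x                                        ∎
  where
  open ≡-Reasoning
  module Sum = CommutativeMonoidSum +-0-commutativeMonoid
  weight-tabulate : ∀ {n} (f : Fin n → ℕ) → weight (tabulate f) ≡ Sum.sum f
  weight-tabulate {zero}  f = refl
  weight-tabulate {suc n} f = cong (f Fin.zero +_) (weight-tabulate (f ∘ Fin.suc))

permute-∨ : ∀ {n} (σ : Permutation′ n) (x y : Vec ℕ n) → permute σ (x ∨ y) ≡ permute σ x ∨ permute σ y
permute-∨ σ x y = trans (Vec.tabulate-cong λ i → Vec.lookup-zipWith _⊔_ (σ ⟨$⟩ʳ i) x y) (tabulate-∨ _ _)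
  where
  tabulate-∨ : ∀ {n} (f g : Fin n → ℕ) → tabulate (λ i → f i ⊔ g i) ≡ tabulate f ∨ tabulate g
  tabulate-∨ {zero}  f g = refl
  tabulate-∨ {suc n} f g = cong (f Fin.zero ⊔ g Fin.zero ∷_) (tabulate-∨ (f ∘ Fin.suc) (g ∘ Fin.suc))

permute-injective : ∀ {n} (σ : Permutation′ n) {x y : Vec ℕ n} → permute σ x ≡ permute σ y → x ≡ y
permute-injective σ {x} {y} eq = begin
  x                    ≡⟨ Vec.tabulate∘lookup x ⟨
  tabulate (lookup x)  ≡⟨ Vec.tabulate-cong same ⟩
  tabulate (lookup y)  ≡⟨ Vec.tabulate∘lookup y ⟩
  y                    ∎
  where
  open ≡-Reasoning
  same : ∀ i → lookup x i ≡ lookup y i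
  same i = begin
    lookup x i                             ≡⟨ cong (lookup x) (inverseʳ σ) ⟨
    lookup x (σ ⟨$⟩ʳ (σ ⟨$⟩ˡ i))            ≡⟨ Vec.lookup∘tabulate _ (σ ⟨$⟩ˡ i) ⟨
    lookup (permute σ x) (σ ⟨$⟩ˡ i)        ≡⟨ cong (λ z → lookup z (σ ⟨$⟩ˡ i)) eq ⟩
    lookup (permute σ y) (σ ⟨$⟩ˡ i)        ≡⟨ Vec.lookup∘tabulate _ (σ ⟨$⟩ˡ i) ⟩
    lookup y (σ ⟨$⟩ʳ (σ ⟨$⟩ˡ i))            ≡⟨ cong (lookup y) (inverseʳ σ) ⟩
    lookup y i                             ∎

binary⇒weight≤ : ∀ {n} (M : Vec ℕ n) → Binary M → weight M ≤ n
binary⇒weight≤ []      bin = z≤n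
binary⇒weight≤ (m ∷ M) bin = +-mono-≤ (bin Fin.zero) (binary⇒weight≤ M (bin ∘ Fin.suc))

toℕ-punchIn-last : ∀ {n} (k : Fin n) → toℕ (punchIn (fromℕ n) k) ≡ toℕ k
toℕ-punchIn-last Fin.zero    = refl
toℕ-punchIn-last (Fin.suc k) = cong suc (toℕ-punchIn-last k)

-- A leading 1 stays in front. A leading 0 moves to the last position, where `etilde` also has a 0
-- because the remaining entries have weight at most their number.
sortBinary : ∀ {n} (M : Vec ℕ n) → Binary M → ∃ λ σ → permute σ M ≡ etilde (weight M)
sortBinary [] bin = id , refl
sortBinary (m ∷ M) bin with sortBinary M (bin ∘ Fin.suc)
sortBinary (suc zero ∷ M) bin | σ , eq = lift₀ σ , cong (1 ∷_) eq
sortBinary (suc (suc _) ∷ M) bin | _ with s≤s () ← bin Fin.zero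
sortBinary {suc n} (zero ∷ M) bin | σ , eq = insert (fromℕ n) Fin.zero σ , Vec.tabulate-cong entry
  where
  entry : ∀ i → lookup (0 ∷ M) (insert (fromℕ n) Fin.zero σ ⟨$⟩ʳ i) ≡
                (if does (toℕ i <? weight M) then 1 else 0)
  entry i with fromℕ n Fin.≟ i
  ... | yes refl = sym (cong (if_then 1 else 0) (dec-false (toℕ (fromℕ n) <? weight M)
          (≤⇒≯ (subst (weight M ≤_) (sym (Fin.toℕ-fromℕ n)) (binary⇒weight≤ M (bin ∘ Fin.suc))))))
  ... | no  i≢ = begin
    lookup M (σ ⟨$⟩ʳ k)                                              ≡⟨ Vec.lookup∘tabulate _ k ⟨
    lookup (permute σ M) k                                          ≡⟨ cong (λ z → lookup z k) eq ⟩
    lookup (etilde (weight M)) k                                    ≡⟨ Vec.lookup∘tabulate _ k ⟩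
    (if does (toℕ k <? weight M) then 1 else 0)                     ≡⟨ cong (λ t → if does (t <? weight M) then 1 else 0) (sym (toℕ-punchIn-last k)) ⟩
    (if does (toℕ (punchIn (fromℕ n) k) <? weight M) then 1 else 0) ≡⟨ cong (λ j → if does (toℕ j <? weight M) then 1 else 0) (Fin.punchIn-punchOut i≢) ⟩
    (if does (toℕ i <? weight M) then 1 else 0)                     ∎
    where open ≡-Reasoning
          k = punchOut i≢

-- Joins of members of the family.

-- Joins of `t` members built one at a time, with the value as an index, so that greedy
-- constructions can extend them.
data Joins {n} (A : List (Vec ℕ n)) : ℕ → Vec ℕ n → Set where
  none : Joins A 0 (replicate n 0)
  add  : ∀ {t a x} → a ∈ A → Joins A t x → Joins A (suc t) (a ∨ x)

Joins⇒join : ∀ {n t} {A : List (Vec ℕ n)} {x} → Joins A t x → Σ (Fin t → Vec ℕ n) λ f → (∀ i → f i ∈ A) × join f ≡ x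
Joins⇒join none = (λ ()) , (λ ()) , refl
Joins⇒join (add {a = a} a∈ js) with Joins⇒join js
... | f , f∈ , eq = (λ { Fin.zero → a ; (Fin.suc i) → f i }) , (λ { Fin.zero → a∈ ; (Fin.suc i) → f∈ i }) , cong (a ∨_) eq

Joins-weight : ∀ {n r s x} {A : List (Vec ℕ n)} → UnionFamily r s A → Joins A r x → weight x ≤ s
Joins-weight uf js with Joins⇒join js
... | f , f∈ , refl = uf f f∈

-- The chosen members may coincide, so all of them can be `a`.
member-weight : ∀ {n r s a} {A : List (Vec ℕ n)} → UnionFamily (suc r) s A → a ∈ A → weight a ≤ s
member-weight {r = r} {a = a} uf a∈ =
  ≤-trans (weight-mono (x≺x∨y a (join {r = r} (λ _ → a)))) (uf (λ _ → a) (λ _ → a∈))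

-- Otherwise `B` lies in one region: the entries on the support of `y` are at most `s` and the
-- weight off it is below `d`. That region is too small to hold `B`.
off-large : ∀ {n s} {B : List (Vec ℕ n)} → Unique B → (∀ {x} → x ∈ B → weight x ≤ s) → ∀ y d →
            suc s ^ weight y * simplex (zeros y) d < length B → ∃ λ a → a ∈ B × d ≤ weightOff y a
off-large {n} {s} {B} u w≤s y d big with any? (λ a → d ≤? weightOff y a) B
... | yes h = find h
... | no ¬h = contradiction big (≤⇒≯ (begin
  length B                                          ≤⟨ unique-⊆⇒length≤ u B⊆ ⟩
  length (region y (replicate n s) d)               ≡⟨ length-region y (replicate n s) d ⟩
  boxes y (replicate n s) * simplex (zeros y) d     ≤⟨ *-monoˡ-≤ (simplex (zeros y) d) (boxes-replicate y s) ⟩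
  suc s ^ weight y * simplex (zeros y) d            ∎))
  where
  open ≤-Reasoning
  B⊆ : B ⊆ region y (replicate n s) d
  B⊆ {x} x∈ = ∈-region⁺ y _ d (Under-replicate y x λ i → ≤-trans (lookup≤weight x i) (w≤s x∈))
                               (≰⇒> λ le → ¬h (lose x∈ le))

module _ {n s d W} {A : List (Vec ℕ (suc n))} {M : Vec ℕ (suc n)}
         (w≤s : ∀ {a} → a ∈ A → weight a ≤ s)
         (pick : ∀ i y → weight y ≤ W → ∃ λ a → a ∈ A × lookup M i ≤ lookup a i × d ≤ weightOff y a) where

  -- Each member is picked with weight at least `d` off the support of all that has been joined
  -- before, so every step gains `d`. The budget `W` allows for an increase of at most `s` per step,
  -- which keeps `pick` applicable.
  gather : ∀ I y → weight y + length I * s ≤ W →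
           ∃ λ x → Joins A (length I) x × (∀ {i} → i ∈ I → lookup M i ≤ lookup x i)
                 × weight y + length I * d ≤ weight (y ∨ x)
  gather [] y h = replicate _ 0 , none , (λ ()) , ≤-trans (≤-reflexive (+-identityʳ _)) (weight-mono (x≺x∨y y _))
  gather (i ∷ I) y h with pick i y (m+n≤o⇒m≤o (weight y) h)
  ... | a , a∈ , Mi≤ , d≤ with gather I (y ∨ a) small
    where
    open ≤-Reasoning
    small : weight (y ∨ a) + length I * s ≤ W
    small = begin
      weight (y ∨ a) + length I * s          ≤⟨ +-monoˡ-≤ _ (weight-∨-≤ y a) ⟩
      weight y + weight a + length I * s     ≤⟨ +-monoˡ-≤ _ (+-monoʳ-≤ (weight y) (w≤s a∈)) ⟩
      weight y + s + length I * s            ≡⟨ +-assoc (weight y) s _ ⟩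
      weight y + (s + length I * s)          ≤⟨ h ⟩
      W                                      ∎
  ... | x , js , above , grown = a ∨ x , add a∈ js , above′ , (begin
      weight y + (d + length I * d)          ≡⟨ +-assoc (weight y) d _ ⟨
      weight y + d + length I * d            ≤⟨ +-monoˡ-≤ _ (+-monoʳ-≤ (weight y) d≤) ⟩
      weight y + weightOff y a + length I * d ≤⟨ +-monoˡ-≤ _ (weight-∨-≥ y a) ⟩
      weight (y ∨ a) + length I * d          ≤⟨ grown ⟩
      weight ((y ∨ a) ∨ x)                   ≡⟨ cong weight (Vec.zipWith-assoc ⊔-assoc y a x) ⟩
      weight (y ∨ (a ∨ x))                   ∎)
    where
    open ≤-Reasoning
    above′ : ∀ {j} → j ∈ i ∷ I → lookup M j ≤ lookup (a ∨ x) j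
    above′ {j} (here refl) = ≤-trans Mi≤ (Pointwise.lookup (x≺x∨y a x) j)
    above′ {j} (there j∈) = ≤-trans (above j∈) (Pointwise.lookup (y≺x∨y a x) j)

  gather-≻ : ∀ j v y → v ≺ M → weight v ≤ j → weight y + j * s ≤ W →
             ∃ λ x → Joins A j x × v ≺ x × weight y + j * d ≤ weight (y ∨ x)
  gather-≻ j v y v≺M v≤j h = conclude length-I h
    where
    -- One member per unit of weight of `v` dominates `v`; the padding coordinate is arbitrary,
    -- since the padded members only have to gain `d`.
    I = support v ++ List.replicate (j ∸ weight v) Fin.zero

    length-I : length I ≡ j
    length-I = trans (length-++ (support v))
      (trans (cong₂ _+_ (length-support v) (length-replicate (j ∸ weight v))) (m+[n∸m]≡n v≤j))

    conclude : ∀ {l} → length I ≡ l → weight y + l * s ≤ W →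
               ∃ λ x → Joins A l x × v ≺ x × weight y + l * d ≤ weight (y ∨ x)
    conclude refl h with gather I y h
    ... | x , js , above , grown = x , js , lookup⁻ v≤x , grown
      where
      v≤x : ∀ i → lookup v i ≤ lookup x i
      v≤x i with 0 <? lookup v i
      ... | yes pos = ≤-trans (Pointwise.lookup v≺M i) (above (∈-++⁺ˡ (∈-support v i pos)))
      ... | no ¬pos = ≤-trans (≮⇒≥ ¬pos) z≤n

-- Greedy choice: while some member has weight above `d` off the current support, joining it gains
-- at least d + 1. After `r` such steps the gain over `e` would be at least r(d + 1) > s, yet a join
-- of `r` members adds at most `s`. Starting from `e` keeps its support inside that of `S`.
cover : ∀ {n r s d} {A : List (Vec ℕ n)} → UnionFamily r s A → (∀ {a} → a ∈ A → weight a ≤ s) →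
        s < r * suc d → ∀ e → ∃ λ S → e ≺ S × weight S ≤ weight e + r * s × (∀ {a} → a ∈ A → weightOff S a ≤ d)
cover {n} {r} {s} {d} {A} uf w≤s s< e = extend r 0 (replicate n 0) (+-identityʳ r) none
  (≤-trans (≤-reflexive (+-identityʳ (weight e))) (weight-mono (x≺x∨y e _)))
  where
  open ≤-Reasoning
  extend : ∀ k t x → k + t ≡ r → Joins A t x → weight e + t * suc d ≤ weight (e ∨ x) →
           ∃ λ S → e ≺ S × weight S ≤ weight e + r * s × (∀ {a} → a ∈ A → weightOff S a ≤ d)
  extend zero t x refl js grown = contradiction s< (≤⇒≯ (+-cancelˡ-≤ (weight e) _ _ (begin
    weight e + t * suc d  ≤⟨ grown ⟩
    weight (e ∨ x)        ≤⟨ weight-∨-≤ e x ⟩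
    weight e + weight x   ≤⟨ +-monoʳ-≤ (weight e) (Joins-weight uf js) ⟩
    weight e + s          ∎)))
  extend (suc k) t x k+t js grown with any? (λ a → d <? weightOff (e ∨ x) a) A
  ... | no none-off = e ∨ x , x≺x∨y e x , (begin
      weight (e ∨ x)        ≤⟨ weight-∨-≤ e x ⟩
      weight e + weight x   ≤⟨ +-monoʳ-≤ (weight e) (Joins-≤ js) ⟩
      weight e + t * s      ≤⟨ +-monoʳ-≤ (weight e) (*-monoˡ-≤ s (≤-trans (m≤n+m t (suc k)) (≤-reflexive k+t))) ⟩
      weight e + r * s      ∎) , λ a∈ → ≮⇒≥ λ lt → none-off (lose a∈ lt)
    where
    weight-0 : ∀ n → weight (replicate n 0) ≡ 0
    weight-0 zero    = refl
    weight-0 (suc n) = weight-0 n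
    Joins-≤ : ∀ {t x} → Joins A t x → weight x ≤ t * s
    Joins-≤ none = ≤-reflexive (weight-0 n)
    Joins-≤ (add {a = a} {x} a∈ js) = ≤-trans (weight-∨-≤ a x) (+-mono-≤ (w≤s a∈) (Joins-≤ js))
  ... | yes some with find some
  ...   | a , a∈ , d< = extend k (suc t) (a ∨ x) (trans (+-suc k t) k+t) (add a∈ js) (begin
      weight e + (suc d + t * suc d)              ≡⟨ solve 3 (λ w d t → w :+ (d :+ t) := w :+ t :+ d) refl (weight e) (suc d) (t * suc d) ⟩
      weight e + t * suc d + suc d                ≤⟨ +-mono-≤ grown d< ⟩
      weight (e ∨ x) + weightOff (e ∨ x) a        ≤⟨ weight-∨-≥ (e ∨ x) a ⟩
      weight ((e ∨ x) ∨ a)                        ≡⟨ cong weight (trans (Vec.zipWith-assoc ⊔-assoc e x a) (cong (e ∨_) (Vec.zipWith-comm ⊔-comm x a))) ⟩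
      weight (e ∨ (a ∨ x))                        ∎)
    where open +-*-Solver

-- Thresholds: the vector `M` of the largest frequently reached entries.

last-holding : ∀ {P : ℕ → Set} → Decidable P → P 0 → ∀ t → ¬ P t → ∃ λ v → P v × ¬ P (suc v)
last-holding P? p₀ zero    ¬p = contradiction p₀ ¬p
last-holding P? p₀ (suc t) ¬p with P? t
... | yes p  = t , p , ¬p
... | no ¬p′ = last-holding P? p₀ t ¬p′

length-concatMap-≤ : ∀ {X Y : Set} {C} (f : X → List Y) → (∀ x → length (f x) ≤ C) →
                     ∀ xs → length (concatMap f xs) ≤ length xs * C
length-concatMap-≤ f h []       = z≤n
length-concatMap-≤ f h (x ∷ xs) =
  ≤-trans (≤-reflexive (length-++ (f x))) (+-mono-≤ (h x) (length-concatMap-≤ f h xs))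

atLeast : ∀ {n} → List (Vec ℕ n) → Fin n → ℕ → List (Vec ℕ n)
atLeast A i v = filter (λ a → v ≤? lookup a i) A

-- The number of members with i-th entry at least `v` is `length A` at v = 0 and 0 at v = s + 1, so
-- it crosses `C` somewhere in between.
thresholds : ∀ {n s C} {A : List (Vec ℕ n)} → (∀ {a} → a ∈ A → weight a ≤ s) → C < length A →
             ∃ λ M → ∀ i → C < length (atLeast A i (lookup M i)) × length (atLeast A i (suc (lookup M i))) ≤ C
thresholds {n} {s} {C} {A} w≤s C<A = tabulate (λ i → proj₁ (threshold i)) , λ i →
  subst (λ v → C < length (atLeast A i v) × length (atLeast A i (suc v)) ≤ C)
        (sym (Vec.lookup∘tabulate (λ i → proj₁ (threshold i)) i))
        (proj₁ (proj₂ (threshold i)) , ≮⇒≥ (proj₂ (proj₂ (threshold i))))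
  where
  all-0 : ∀ i → atLeast A i 0 ≡ A
  all-0 i = filter-all (λ a → 0 ≤? lookup a i) {xs = A} (All.tabulate λ _ → z≤n)

  none-above : ∀ i → atLeast A i (suc s) ≡ []
  none-above i = filter-none (λ a → suc s ≤? lookup a i) {xs = A}
    (All.tabulate λ {a} a∈ s<a → <⇒≱ s<a (≤-trans (lookup≤weight a i) (w≤s a∈)))

  threshold : ∀ i → ∃ λ v → C < length (atLeast A i v) × ¬ C < length (atLeast A i (suc v))
  threshold i = last-holding (λ v → C <? length (atLeast A i v))
    (subst (C <_) (sym (cong length (all-0 i))) C<A) (suc s)
    (λ lt → n≮0 (subst (C <_) (cong length (none-above i)) lt))

-- Dichotomy: the family is small or bounded by a binary vector.

module _ {n r s d p} (s≡ : s ≡ d * suc r + p) (p<r : p < suc r) (p≤n : p ≤ suc n)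
         {A : List (Vec ℕ (suc n))} (u : Unique A) (uf : UnionFamily (suc r) s A)
         (C : ℕ) (C≥ : suc s ^ (suc p + suc r * s + p) * simplex (zeros (etilde {suc n} p)) d ≤ C)
         (growth : suc (p + suc r * s) * C < simplex (zeros (etilde {suc n} p)) (suc d)) where

  private
    e = etilde {suc n} p
    k = zeros e
    -- `Q` bounds the weight of the support found by `cover`. `W` is the weight budget of `gather`:
    -- a start of weight at most p + 1 and r + 1 members of weight at most `s`.
    Q = p + suc r * s
    W = suc p + suc r * s

    w≤s : ∀ {a} → a ∈ A → weight a ≤ s
    w≤s = member-weight {r = r} uf

    module Crowded {M : Vec ℕ (suc n)} (many : ∀ i → C < length (atLeast A i (lookup M i)))
                   (few : ∀ i → length (atLeast A i (suc (lookup M i))) ≤ C) where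
      -- Enlarging `y` to `y ∨ e` leaves at most `k` free coordinates, so that the single constant
      -- `C` serves every `y`; the additional `p` in its exponent is the weight of `e`.
      pick : ∀ i y → weight y ≤ W → ∃ λ a → a ∈ A × lookup M i ≤ lookup a i × d ≤ weightOff y a
      pick i y y≤W with off-large (Unique.filter⁺ (λ a → lookup M i ≤? lookup a i) u)
                                  (λ a∈ → w≤s (proj₁ (∈-filter⁻ (λ a → lookup M i ≤? lookup a i) a∈)))
                                  (y ∨ e) d (≤-<-trans bound (many i))
        where
        bound : suc s ^ weight (y ∨ e) * simplex (zeros (y ∨ e)) d ≤ C
        bound = ≤-trans (*-mono-≤
          (^-monoʳ-≤ (suc s) (≤-trans (weight-∨-≤ y e) (+-mono-≤ y≤W (≤-reflexive (weight-etilde p≤n)))))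
          (simplex-mono d (zeros-antitone (y≺x∨y y e)))) C≥
      ... | a , a∈ , d≤ with ∈-filter⁻ (λ a → lookup M i ≤? lookup a i) a∈
      ...   | a∈A , Mi≤ = a , a∈A , Mi≤ , ≤-trans d≤ (weightOff-antitone (x≺x∨y y e) a)

      -- If `M` were heavier, take `v` of weight p + 1 below it. As p + 1 ≤ r + 1, a join of r + 1
      -- members can dominate `v` and gain `d` each time, reaching weight p + 1 + (r + 1)d = s + 1.
      weight-M : weight M ≤ p
      weight-M = ≮⇒≥ tooHeavy
        where
        open ≤-Reasoning
        tooHeavy : ¬ p < weight M
        tooHeavy p<M with truncate M p<M
        ... | v , v≺M , wv with gather-≻ w≤s pick (suc r) v v v≺M (≤-trans (≤-reflexive wv) p<r)
                                (≤-reflexive (cong (_+ suc r * s) wv))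
        ...   | x , js , v≺x , grown = <-irrefl refl (begin-strict
          s                      ≡⟨ s≡ ⟩
          d * suc r + p          <⟨ n<1+n _ ⟩
          suc (d * suc r + p)    ≡⟨ solve 3 (λ d r p → con 1 :+ (d :* r :+ p) := con 1 :+ p :+ r :* d) refl d (suc r) p ⟩
          suc p + suc r * d      ≡⟨ cong (_+ suc r * d) wv ⟨
          weight v + suc r * d   ≤⟨ grown ⟩
          weight (v ∨ x)         ≤⟨ weight-mono (∨-lub v≺x ≺-refl) ⟩
          weight x               ≤⟨ Joins-weight uf js ⟩
          s                      ∎)
          where open +-*-Solver

      -- As `M` has weight at most `r`, some `r` members dominate it while gaining r · d over
      -- `a ∨ M`. With `a` itself this is a join of r + 1 members, so the total is at most `s`.
      weight-∨M : ∀ {a} → a ∈ A → weight (a ∨ M) ≤ d + p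
      weight-∨M {a} a∈ = conclude (gather-≻ w≤s pick r M (a ∨ M) ≺-refl (≤-trans weight-M (≤-pred p<r)) bound)
        where
        open ≤-Reasoning
        bound : weight (a ∨ M) + r * s ≤ W
        bound = begin
          weight (a ∨ M) + r * s         ≤⟨ +-monoˡ-≤ (r * s) (weight-∨-≤ a M) ⟩
          weight a + weight M + r * s    ≤⟨ +-monoˡ-≤ (r * s) (+-mono-≤ (w≤s a∈) (m≤n⇒m≤1+n weight-M)) ⟩
          s + suc p + r * s              ≡⟨ trans (cong (_+ r * s) (+-comm s (suc p))) (+-assoc (suc p) s (r * s)) ⟩
          W                              ∎

        conclude : (∃ λ x → Joins A r x × M ≺ x × weight (a ∨ M) + r * d ≤ weight ((a ∨ M) ∨ x)) →
                   weight (a ∨ M) ≤ d + p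
        conclude (x , js , M≺x , grown) = +-cancelʳ-≤ (r * d) (weight (a ∨ M)) (d + p) (begin
          weight (a ∨ M) + r * d    ≤⟨ grown ⟩
          weight ((a ∨ M) ∨ x)      ≤⟨ weight-mono (∨-lub (∨-lub (x≺x∨y a x) (≺-trans M≺x (y≺x∨y a x))) (y≺x∨y a x)) ⟩
          weight (a ∨ x)            ≤⟨ Joins-weight uf (add a∈ js) ⟩
          s                         ≡⟨ s≡ ⟩
          d * suc r + p             ≡⟨ solve 3 (λ d r p → d :* (con 1 :+ r) :+ p := d :+ p :+ r :* d) refl d r p ⟩
          d + p + r * d             ∎)
          where open +-*-Solver

      -- The product over `S` falls short of 2^p by at least 1, hence the main term by at least `N`,
      -- and by `growth` this gap exceeds the number of exceptional members.
      sparse : (∀ S → boxes S M < 2 ^ p) → length A < 2 ^ p * simplex k (suc d)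
      sparse small = count (cover uf w≤s s< e)
        where
        open ≤-Reasoning
        N = simplex k (suc d)

        s< : s < suc r * suc d
        s< = begin-strict
          s                    ≡⟨ s≡ ⟩
          d * suc r + p        <⟨ +-monoʳ-< (d * suc r) p<r ⟩
          d * suc r + suc r    ≡⟨ solve 2 (λ d r → d :* r :+ r := r :* (con 1 :+ d)) refl d (suc r) ⟩
          suc r * suc d        ∎
          where open +-*-Solver

        count : (∃ λ S → e ≺ S × weight S ≤ weight e + suc r * s × (∀ {a} → a ∈ A → weightOff S a ≤ d)) →
                length A < 2 ^ p * N
        count (S , e≺S , wS , off) = begin-strict
          length A                                            ≤⟨ unique-⊆⇒length≤ u A⊆ ⟩
          length (region S M (suc d) ++ exceptional)          ≡⟨ length-++ (region S M (suc d)) ⟩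
          length (region S M (suc d)) + length exceptional    ≤⟨ +-mono-≤ region≤ exceptional≤ ⟩
          boxes S M * N + Q * C                               ≤⟨ +-monoʳ-≤ (boxes S M * N) (m≤n+m (Q * C) C) ⟩
          boxes S M * N + suc Q * C                           <⟨ +-monoʳ-< (boxes S M * N) growth ⟩
          boxes S M * N + N                                   ≡⟨ +-comm (boxes S M * N) N ⟩
          suc (boxes S M) * N                                 ≤⟨ *-monoˡ-≤ N (small S) ⟩
          2 ^ p * N                                           ∎
          where
          -- At most `C` members exceed `M` at any one coordinate; repetitions in `support S` only
          -- lengthen the list.
          exceptional = concatMap (λ i → atLeast A i (suc (lookup M i))) (support S)

          region≤ : length (region S M (suc d)) ≤ boxes S M * N
          region≤ = ≤-trans (≤-reflexive (length-region S M (suc d)))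
                            (*-monoʳ-≤ (boxes S M) (simplex-mono (suc d) (zeros-antitone e≺S)))

          exceptional≤ : length exceptional ≤ Q * C
          exceptional≤ = ≤-trans (length-concatMap-≤ _ few (support S)) (*-monoˡ-≤ C (begin
            length (support S)        ≡⟨ length-support S ⟩
            weight S                  ≤⟨ wS ⟩
            weight e + suc r * s      ≡⟨ cong (_+ suc r * s) (weight-etilde p≤n) ⟩
            Q                         ∎))

          A⊆ : A ⊆ region S M (suc d) ++ exceptional
          A⊆ {a} a∈ with Under-or-exceeds S M a
          ... | inj₁ under        = ∈-++⁺ˡ (∈-region⁺ S M (suc d) under (s≤s (off a∈)))
          ... | inj₂ (i , i∈ , h) = ∈-++⁺ʳ (region S M (suc d))
            (∈-concatMap⁺ (λ i → atLeast A i (suc (lookup M i)))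
              (lose i∈ (∈-filter⁺ (λ a → suc (lookup M i) ≤? lookup a i) a∈ h)))

  small-or-structured :
    length A < 2 ^ p * simplex k (suc d) ⊎
    ∃ λ M → Binary M × weight M ≡ p × (∀ {a} → a ∈ A → weight (a ∨ M) ≤ d + p)
  small-or-structured with C <? length A
  ... | no C≮A = inj₁ (begin-strict
      length A                     ≤⟨ ≮⇒≥ C≮A ⟩
      C                            ≤⟨ m≤m+n C (Q * C) ⟩
      suc Q * C                    <⟨ growth ⟩
      simplex k (suc d)            ≤⟨ m≤n*m _ (2 ^ p) {{>-nonZero (m^n>0 2 p)}} ⟩
      2 ^ p * simplex k (suc d)    ∎)
    where open ≤-Reasoning
  ... | yes C<A with thresholds w≤s C<A
  ...   | M , both = cases (m≤n⇒m<n∨m≡n weight-M)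
    where
    open Crowded {M} (λ i → proj₁ (both i)) (λ i → proj₂ (both i))
    Structured = ∃ λ M → Binary M × weight M ≡ p × (∀ {a} → a ∈ A → weight (a ∨ M) ≤ d + p)

    -- A weight below `p` and an entry above 1 each force the product below 2^p for every support.
    cases : weight M < p ⊎ weight M ≡ p → length A < 2 ^ p * simplex k (suc d) ⊎ Structured
    cases (inj₁ M<p) = inj₁ (sparse λ S → ≤-<-trans (boxes-≤ S M) (^-monoʳ-< 2 ≤-refl M<p))
    cases (inj₂ M≡p) with binary? M
    ... | yes bin = inj₂ (M , bin , M≡p , weight-∨M)
    ... | no ¬bin = inj₁ (sparse λ S → subst (λ w → boxes S M < 2 ^ w) M≡p (boxes-< S M ¬bin))

-- Choice of the bound on n and comparison with the extremal family.

theorem1 : (r s d p : ℕ) → 2 ≤ r → 1 ≤ s → s ≡ d * r + p → p < r →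
    Σ ℕ λ n₀ → (n : ℕ) → n₀ < n →
    (A : List (Vec ℕ n)) → Unique A → UnionFamily r s A →
    (L : List (Vec ℕ n)) → Enumerates L (Down (Up (etilde p) d)) →
    (length A ≤ length L)
    × (length A ≡ length L → IsomorphicTo A (Down (Up (etilde p) d)))
-- For n > p + c · d the number `k` of zeros of `etilde p` is at least c · d, as `simplex-growth`
-- requires. The factor `K` of `c` makes K · simplex k d an admissible `C`.
theorem1 (suc r) s d p 2≤r 1≤s s≡ p<r = p + c * d , extremal
  where
  K = suc s ^ (suc p + suc r * s + p)
  c = suc (p + suc r * s) * K

  extremal : (n : ℕ) → p + c * d < n →
    (A : List (Vec ℕ n)) → Unique A → UnionFamily (suc r) s A →
    (L : List (Vec ℕ n)) → Enumerates L (Down (Up (etilde p) d)) →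
    (length A ≤ length L)
    × (length A ≡ length L → IsomorphicTo A (Down (Up (etilde p) d)))
  extremal (suc n) n₀<n A u uf L (uL , L⇔) =
    conclude (small-or-structured s≡ p<r p≤n u uf (K * simplex k d) ≤-refl growth)
    where
    e = etilde {suc n} p
    k = zeros e

    p≤n : p ≤ suc n
    p≤n = m+n≤o⇒m≤o p (<⇒≤ n₀<n)

    growth : suc (p + suc r * s) * (K * simplex k d) < simplex k (suc d)
    growth = subst (_< simplex k (suc d)) (*-assoc (suc (p + suc r * s)) K (simplex k d))
      (simplex-growth c k d (+-cancelˡ-≤ p (c * d) k
        (≤-trans (<⇒≤ n₀<n) (≤-reflexive (sym (zeros-etilde p≤n))))))

    ∈L : ∀ {x} → weight (x ∨ e) ≤ d + p → x ∈ L
    ∈L {x} h = Equivalence.from (L⇔ x) (Down-Up⁺ (subst (λ w → weight (x ∨ e) ≤ d + w) (sym (weight-etilde p≤n)) h))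

    region⊆L : region e e (suc d) ⊆ L
    region⊆L {x} x∈ = ∈L (begin
      weight (x ∨ e)               ≡⟨ Under-self e x (proj₁ inside) ⟩
      weight e + weightOff e x     ≡⟨ cong (_+ weightOff e x) (weight-etilde p≤n) ⟩
      p + weightOff e x            ≤⟨ +-monoʳ-≤ p (≤-pred (proj₂ inside)) ⟩
      p + d                        ≡⟨ +-comm p d ⟩
      d + p                        ∎)
      where
      open ≤-Reasoning
      inside = ∈-region⁻ e e (suc d) x∈

    -- Entries 0 or 1 on the first `p` coordinates combine freely with any vector of weight at most
    -- `d` on the other `k`.
    2^p*simplex≤L : 2 ^ p * simplex k (suc d) ≤ length L
    2^p*simplex≤L = begin
      2 ^ p * simplex k (suc d)          ≡⟨ cong (_* simplex k (suc d)) (boxes-etilde p≤n) ⟨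
      boxes e e * simplex k (suc d)      ≡⟨ length-region e e (suc d) ⟨
      length (region e e (suc d))        ≤⟨ unique-⊆⇒length≤ (region-unique e e (suc d)) region⊆L ⟩
      length L                           ∎
      where open ≤-Reasoning

    Goal = (length A ≤ length L) × (length A ≡ length L → IsomorphicTo A (Down (Up e d)))

    conclude : (length A < 2 ^ p * simplex k (suc d) ⊎
                ∃ λ M → Binary M × weight M ≡ p × (∀ {a} → a ∈ A → weight (a ∨ M) ≤ d + p)) → Goal
    conclude (inj₁ A<) = <⇒≤ A<L , λ A≡L → contradiction A≡L (<⇒≢ A<L)
      where
      A<L : length A < length L
      A<L = <-≤-trans A< 2^p*simplex≤L
    conclude (inj₂ (M , bin , refl , bounded)) = A≤L , isomorphic
      where
      σ = proj₁ (sortBinary M bin)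

      -- Sorting takes `M` to `e` and preserves the weights of joins, so the bound against `M`
      -- becomes one against `e`.
      permuted∈L : ∀ {a} → a ∈ A → permute σ a ∈ L
      permuted∈L {a} a∈ = ∈L (subst (_≤ d + p) weight-permuted (bounded a∈))
        where
        open ≡-Reasoning
        weight-permuted : weight (a ∨ M) ≡ weight (permute σ a ∨ e)
        weight-permuted = begin
          weight (a ∨ M)                        ≡⟨ weight-permute σ (a ∨ M) ⟨
          weight (permute σ (a ∨ M))            ≡⟨ cong weight (permute-∨ σ a M) ⟩
          weight (permute σ a ∨ permute σ M)    ≡⟨ cong (λ z → weight (permute σ a ∨ z)) (proj₂ (sortBinary M bin)) ⟩
          weight (permute σ a ∨ e)              ∎

      σA = List.map (permute σ) A

      σA-unique : Unique σA
      σA-unique = Unique.map⁺ (permute-injective σ) u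

      σA⊆L : σA ⊆ L
      σA⊆L x∈ with ∈-map⁻ (permute σ) x∈
      ... | a , a∈ , refl = permuted∈L a∈

      A≤L : length A ≤ length L
      A≤L = subst (_≤ length L) (length-map (permute σ) A) (unique-⊆⇒length≤ σA-unique σA⊆L)

      -- The inclusion of the permuted family in `L` is an equality when the lengths agree.
      isomorphic : length A ≡ length L → IsomorphicTo A (Down (Up e d))
      isomorphic A≡L = σ , λ a → mk⇔ (λ a∈ → Equivalence.to (L⇔ (permute σ a)) (permuted∈L a∈)) (reflect a)
        where
        L⊆σA : L ⊆ σA
        L⊆σA = unique-⊆-length≥⇒⊇ (Vec.≡-dec _≟_) σA-unique σA⊆L
          (≤-reflexive (trans (sym A≡L) (sym (length-map (permute σ) A))))

        reflect : ∀ a → Down (Up e d) (permute σ a) → a ∈ A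
        reflect a h with ∈-map⁻ (permute σ) (L⊆σA (Equivalence.from (L⇔ (permute σ a)) h))
        ... | a′ , a′∈ , eq = subst (_∈ A) (sym (permute-injective σ eq)) a′∈
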